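{- Let $G$ be a finite, simple, connected 3-regular graph. Then $\mathrm{gndi}_{\Sigma}(G)\le 4$; that is, there exists an edge coloring $f:E(G)\to\{1,2,3,4\}$ such that for every edge $xy\in E(G)$ we have $\sigma(x)\neq\sigma(y)$, where $\sigma(x)=\sum_{e\ni x} f(e)$ is the sum of the colors of the edges incident to $x$.
   Context: For a graph $G$ and a positive integer $k$, a $k$-coloring is a map $f:E(G)\to[k]=\{1,\dots,k\}$. It is a neighbor sum distinguishing edge coloring if $\sigma(x)\ne\sigma(y)$ for every edge $xy$, where $\sigma(x)=\sum_{e\ni x}f(e)$. $\mathrm{gndi}_{\Sigma}(G)$ is the minimum $k$ for which such a $k$-coloring exists. -}

module Defs where

open import Data.Nat using (ℕ; zero; suc; _+_)
open import Data.Fin using (Fin; toℕ)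
open import Data.List using (List; filter; length; map; allFin)
open import Data.Nat.ListAction using (sum)

open import Relation.Nullary using (¬_; Dec)

open import Relation.Binary.PropositionalEquality using (_≡_; _≢_)

record Graph (n : ℕ) : Set₁ where
  field
    Adj     : Fin n → Fin n → Set
    adj?    : (u v : Fin n) → Dec (Adj u v)
    sym     : ∀ {u v} → Adj u v → Adj v u
    irrefl  : ∀ {u} → ¬ Adj u u

open Graph public

neighbours : ∀ {n} (G : Graph n) → Fin n → List (Fin n)
neighbours G x = filter (adj? G x) (allFin _)

degree : ∀ {n} (G : Graph n) → Fin n → ℕ
degree G x = length (neighbours G x)

Regular : ∀ {n} → ℕ → Graph n → Set
Regular k G = ∀ x → degree G x ≡ k

data Walk {n} (G : Graph n) : Fin n → Fin n → Set where
  here  : ∀ {u} → Walk G u u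
  step  : ∀ {u w v} → Adj G u w → Walk G w v → Walk G u v

Connected : ∀ {n} → Graph n → Set
Connected {n} G = (u v : Fin n) → Walk G u v

-- An edge colouring with colours in [k] = {1,…,k}: assigns to each
-- (unordered) pair a colour in Fin k, read as colour toℕ c + 1;
-- symmetry makes it a function on unordered edges. Values on non-edges
-- are irrelevant.
record EdgeColouring {n} (G : Graph n) (k : ℕ) : Set where
  field
    col     : Fin n → Fin n → Fin k
    col-sym : ∀ u v → col u v ≡ col v u

open EdgeColouring public

colourValue : ∀ {k} → Fin k → ℕ
colourValue c = suc (toℕ c)

σ : ∀ {n k} {G : Graph n} → EdgeColouring G k → Fin n → ℕ
σ {G = G} f x = sum (map (λ y → colourValue (col f x y)) (neighbours G x))

NeighbourSumDistinguishing : ∀ {n k} {G : Graph n} → EdgeColouring G k → Set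
NeighbourSumDistinguishing {n} {G = G} f =
  ∀ (x y : Fin n) → Adj G x y → σ f x ≢ σ f y

{-# OPTIONS --safe #-}
module Submission where

-- Work with integer edge weights and reduce them modulo 4 to {1,2,3,4} at the end. Alternating weights a, -a, a, …
-- along a walk from v to a root r change the sums at v and r only, so any prescribed vertex sums t can be reached
-- except at r, where an error remains whose parity is that of ∑ t.
--
-- If G is not bipartite, an odd closed walk through r changes the sum at r alone, by any even amount, so every t
-- with ∑ t even is reachable. A greedy proper 4-colouring, with colours suitably relabelled by residues modulo 4,
-- has an even sum.
--
-- If G is bipartite, prescribe 0 on the side of r and 1 on the other side. The sum at r is then acceptable unless
-- it is 1 modulo 4, and in that case adding 1 to two edges at r repairs it.

open import Defs
open import Data.Nat using (ℕ)
open import Data.Product using (Σ)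

open import Data.Bool using (Bool; true; false; not; if_then_else_)
import Data.Bool.Properties as Bool
open import Data.Fin using (Fin; zero; suc; fromℕ<; _≟_)
open import Data.Fin.Patterns using (0F; 1F; 2F; 3F)
open import Data.Fin.Properties using (any?; all?; pigeonhole; toℕ-fromℕ<; <⇒≢)
open import Data.Integer using (ℤ; +_; _+_; _*_; -_; _-_; 0ℤ; 1ℤ; _%ℕ_; _/ℕ_)
open import Data.Integer.DivMod using (n%ℕd<d; a≡a%ℕn+[a/ℕn]*n)
open import Data.Integer.Divisibility.Signed
import Data.Integer.Properties as ℤ
open import Data.Integer.Tactic.RingSolver using (solve-∀)
open import Data.List using (List; []; _∷_; length; map; filter; tabulate; allFin)
open import Data.List.Properties using (length-map)
open import Data.List.Membership.Propositional using (_∈_; _∉_)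
open import Data.List.Membership.Propositional.Properties using (∈-filter⁺; ∈-allFin; ∈-map⁺)
import Data.List.Membership.DecPropositional as DecMembership
import Data.List.Membership.Setoid.Properties as SetoidMembership
open import Data.List.Relation.Unary.All using ([]; _∷_)
open import Data.List.Relation.Unary.All.Properties using (all-filter)
open import Data.List.Relation.Unary.AllPairs using ([]; _∷_)
open import Data.List.Relation.Unary.Any using (here; there; index)
open import Data.List.Relation.Unary.Unique.Propositional.Properties using (allFin⁺; filter⁺)
import Data.Nat as ℕ
import Data.Nat.Properties as ℕ
open import Data.Nat.ListAction using () renaming (sum to sumℕ)
open import Data.Product using (∃; ∃₂; _×_; _,_)
open import Data.Sum using (_⊎_; [_,_]′; inj₁; inj₂)
open import Data.Vec.Functional using (updateAt)
open import Data.Vec.Functional.Properties using (updateAt-updates; updateAt-minimal)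
open import Function using (_∘_; id; const)
open import Relation.Nullary using (¬_; Dec; yes; no; does; contradiction; ¬?; _×-dec_; _→-dec_)
open import Relation.Nullary.Decidable using (from-no; from-yes; decidable-stable)
open import Relation.Binary.PropositionalEquality renaming (sym to ≡-sym)
open ≡-Reasoning

open import Algebra.Properties.Semiring.Sum ℤ.+-*-semiring using (sum; sum-cong-≗; ∑-distrib-+; sum-replicate-zero; *-distribˡ-sum; *-distribʳ-sum)

private
  variable
    n m : ℕ

-- Kronecker delta and finite sums.

-- Structural recursion, rather than a test by `_≟_`, lets `δ` reduce in step with `sum` in `sum-δ`.
δ : Fin n → Fin n → ℤ
δ zero    zero    = 1ℤ
δ zero    (suc _) = 0ℤ
δ (suc _) zero    = 0ℤ
δ (suc i) (suc j) = δ i j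

δ-refl : (i : Fin n) → δ i i ≡ 1ℤ
δ-refl zero    = refl
δ-refl (suc i) = δ-refl i

δ-≢ : {i j : Fin n} → i ≢ j → δ i j ≡ 0ℤ
δ-≢ {i = zero}  {zero}  i≢j = contradiction refl i≢j
δ-≢ {i = zero}  {suc j} i≢j = refl
δ-≢ {i = suc i} {zero}  i≢j = refl
δ-≢ {i = suc i} {suc j} i≢j = δ-≢ (i≢j ∘ cong suc)

δ-0⊎1 : (i j : Fin n) → δ i j ≡ 0ℤ ⊎ δ i j ≡ 1ℤ
δ-0⊎1 i j with i ≟ j
... | yes refl = inj₂ (δ-refl i)
... | no  i≢j  = inj₁ (δ-≢ i≢j)

δ-+-0⊎1 : {i j : Fin n} → i ≢ j → ∀ k → δ i k + δ j k ≡ 0ℤ ⊎ δ i k + δ j k ≡ 1ℤ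
δ-+-0⊎1 {i = i} {j} i≢j k with i ≟ k | j ≟ k
... | yes refl | yes refl = contradiction refl i≢j
... | yes refl | no  j≢k  = inj₂ (cong₂ _+_ (δ-refl i) (δ-≢ j≢k))
... | no  i≢k  | yes refl = inj₂ (cong₂ _+_ (δ-≢ i≢k) (δ-refl j))
... | no  i≢k  | no  j≢k  = inj₁ (cong₂ _+_ (δ-≢ i≢k) (δ-≢ j≢k))

sum-zero : {f : Fin n → ℤ} → (∀ i → f i ≡ 0ℤ) → sum f ≡ 0ℤ
sum-zero {n} f≡0 = trans (sum-cong-≗ f≡0) (sum-replicate-zero n)

sum-δ : (f : Fin n → ℤ) (j : Fin n) → sum (λ i → δ j i * f i) ≡ f j
sum-δ f zero = begin
  1ℤ * f zero + sum (λ i → 0ℤ * f (suc i)) ≡⟨ cong₂ _+_ (ℤ.*-identityˡ (f zero)) (sum-zero (λ i → ℤ.*-zeroˡ (f (suc i)))) ⟩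
  f zero + 0ℤ                              ≡⟨ ℤ.+-identityʳ (f zero) ⟩
  f zero                                   ∎
sum-δ f (suc j) = begin
  0ℤ * f zero + sum (λ i → δ j i * f (suc i)) ≡⟨ cong₂ _+_ (ℤ.*-zeroˡ (f zero)) (sum-δ (f ∘ suc) j) ⟩
  0ℤ + f (suc j)                              ≡⟨ ℤ.+-identityˡ _ ⟩
  f (suc j)                                   ∎

∣0 : ∀ k → k ∣ 0ℤ
∣0 k = divides 0ℤ (≡-sym (ℤ.*-zeroˡ k))

∣-sum : ∀ {k} {f : Fin n → ℤ} → (∀ i → k ∣ f i) → k ∣ sum f
∣-sum {ℕ.zero}  {k} k∣f = ∣0 k
∣-sum {ℕ.suc n}     k∣f = ∣m∣n⇒∣m+n (k∣f zero) (∣-sum (k∣f ∘ suc))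

indicator : ∀ {P : Set} → Dec P → ℤ
indicator P? = if does P? then 1ℤ else 0ℤ

indicator-yes : ∀ {P : Set} (P? : Dec P) → P → indicator P? ≡ 1ℤ
indicator-yes (yes _) p = refl
indicator-yes (no ¬p) p = contradiction p ¬p

-- Turns the list sum in `σ` into a sum over all vertices; `allFin` is the case `f = id`, and the
-- induction needs `f` arbitrary.
sum-filter-tabulate : {A : Set} {P : A → Set} (P? : ∀ a → Dec (P a)) (g : A → ℕ) (f : Fin n → A) →
  + sumℕ (map g (filter P? (tabulate f))) ≡ sum (λ i → indicator (P? (f i)) * + g (f i))
sum-filter-tabulate {ℕ.zero}  P? g f = refl
sum-filter-tabulate {ℕ.suc n} P? g f with P? (f zero)
... | yes _ = cong₂ _+_ (≡-sym (ℤ.*-identityˡ (+ g (f zero)))) (sum-filter-tabulate P? g (f ∘ suc))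
... | no  _ = trans (sum-filter-tabulate P? g (f ∘ suc)) (≡-sym (ℤ.+-identityˡ _))

-- Realisable vertex sums

-- Integer weights, unlike colours, can be added and can cancel. The indicator discards their values
-- on non-edges.
record Realisable (G : Graph n) (t : Fin n → ℤ) : Set where
  field
    weight     : Fin n → Fin n → ℤ
    weight-sym : ∀ u v → weight u v ≡ weight v u
    weight-sum : ∀ x → sum (λ y → indicator (adj? G x y) * weight x y) ≡ t x

open Realisable

module _ {G : Graph n} where

  realisable-cong : {s t : Fin n → ℤ} → (∀ x → s x ≡ t x) → Realisable G s → Realisable G t
  realisable-cong s≗t R = record
    { weight     = weight R
    ; weight-sym = weight-sym R
    ; weight-sum = λ x → trans (weight-sum R x) (s≗t x)
    }

  realisable-0 : Realisable G (const 0ℤ)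
  realisable-0 = record
    { weight     = λ _ _ → 0ℤ
    ; weight-sym = λ _ _ → refl
    ; weight-sum = λ x → sum-zero (λ y → ℤ.*-zeroʳ (indicator (adj? G x y)))
    }

  realisable-+ : {s t : Fin n → ℤ} → Realisable G s → Realisable G t → Realisable G (λ x → s x + t x)
  realisable-+ R S = record
    { weight     = λ u v → weight R u v + weight S u v
    ; weight-sym = λ u v → cong₂ _+_ (weight-sym R u v) (weight-sym S u v)
    ; weight-sum = λ x →
        trans (sum-cong-≗ (λ y → ℤ.*-distribˡ-+ (indicator (adj? G x y)) (weight R x y) (weight S x y)))
        (trans (∑-distrib-+ (λ y → indicator (adj? G x y) * weight R x y) _)
               (cong₂ _+_ (weight-sum R x) (weight-sum S x)))
    }

  realisable-sum : {f : Fin m → Fin n → ℤ} → (∀ i → Realisable G (f i)) → Realisable G (λ x → sum (λ i → f i x))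
  realisable-sum {ℕ.zero}  R = realisable-0
  realisable-sum {ℕ.suc m} R = realisable-+ (R zero) (realisable-sum (R ∘ suc))

  δ-indicator : ∀ {u v} → Adj G u v → ∀ x → δ u x * indicator (adj? G x v) ≡ δ u x
  δ-indicator {u} {v} uv x with u ≟ x
  ... | yes refl rewrite δ-refl u | indicator-yes (adj? G u v) uv = refl
  ... | no  u≢x  rewrite δ-≢ u≢x = ℤ.*-zeroˡ (indicator (adj? G x v))

  realisable-edge : ∀ {u v} → Adj G u v → ∀ a → Realisable G (λ x → a * δ u x + a * δ v x)
  realisable-edge {u} {v} uv a = record
    -- The factor of `a` is the indicator of the unordered pair of `u` and `v`, written
    -- symmetrically.
    { weight     = λ x y → a * (δ u x * δ v y + δ u y * δ v x)
    ; weight-sym = λ x y → cong (a *_) (ℤ.+-comm (δ u x * δ v y) (δ u y * δ v x))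
    ; weight-sum = weight-sum-edge
    }
    where
    expand : ∀ i a p q r s → i * (a * (p * q + r * s)) ≡ q * (a * (p * i)) + r * (a * (s * i))
    expand = solve-∀

    weight-sum-edge : ∀ x → sum (λ y → indicator (adj? G x y) * (a * (δ u x * δ v y + δ u y * δ v x)))
                            ≡ a * δ u x + a * δ v x
    weight-sum-edge x = begin
      sum (λ y → I y * (a * (δ u x * δ v y + δ u y * δ v x)))
        ≡⟨ sum-cong-≗ (λ y → expand (I y) a (δ u x) (δ v y) (δ u y) (δ v x)) ⟩
      sum (λ y → δ v y * (a * (δ u x * I y)) + δ u y * (a * (δ v x * I y)))
        ≡⟨ ∑-distrib-+ (λ y → δ v y * (a * (δ u x * I y))) _ ⟩
      sum (λ y → δ v y * (a * (δ u x * I y))) + sum (λ y → δ u y * (a * (δ v x * I y)))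
        ≡⟨ cong₂ _+_ (sum-δ (λ y → a * (δ u x * I y)) v) (sum-δ (λ y → a * (δ v x * I y)) u) ⟩
      a * (δ u x * I v) + a * (δ v x * I u)
        ≡⟨ cong₂ (λ p q → a * p + a * q) (δ-indicator uv x) (δ-indicator (sym G uv) x) ⟩
      a * δ u x + a * δ v x ∎
      where
      I : Fin n → ℤ
      I y = indicator (adj? G x y)

  odd? : ∀ {u v} → Walk G u v → Bool
  odd? here       = false
  odd? (step _ p) = not (odd? p)

  -- The sign with which `a` arrives at the far end of an alternately weighted walk: plus for odd
  -- length, minus for even length.
  sign : Bool → ℤ
  sign true  = 1ℤ
  sign false = - 1ℤ

  sign-not : ∀ b a → sign b * - a ≡ sign (not b) * a
  sign-not true  = solve-∀
  sign-not false = solve-∀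

  -- Weight the edges of the walk alternately a, -a, a, …: the contributions at interior vertices cancel.
  realisable-walk : ∀ {u v} (p : Walk G u v) a → Realisable G (λ x → a * δ u x + (sign (odd? p) * a) * δ v x)
  realisable-walk {u} here a = realisable-cong (λ x → cancel a (δ u x)) realisable-0
    where
    cancel : ∀ a d → 0ℤ ≡ a * d + (- 1ℤ * a) * d
    cancel = solve-∀
  realisable-walk {u} {v} (step {w = w} uw p) a = realisable-cong telescope
    (realisable-+ (realisable-edge uw a) (realisable-walk p (- a)))
    where
    regroup : ∀ a d e f → a * d + a * e + (- a * e + f) ≡ a * d + f
    regroup = solve-∀

    telescope : ∀ x → a * δ u x + a * δ w x + (- a * δ w x + (sign (odd? p) * - a) * δ v x)
                      ≡ a * δ u x + (sign (not (odd? p)) * a) * δ v x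
    telescope x = trans (regroup a (δ u x) (δ w x) _)
      (cong (λ z → a * δ u x + z * δ v x) (sign-not (odd? p) a))

  -- Shifting all errors to a root

  module _ (connected : Connected G) (r : Fin n) where

    -- This is the parity of the walk that `connected` supplies, not of a distance. Even `parity r`
    -- may be `true`, so sides are later compared with that of `r`.
    parity : Fin n → Bool
    parity v = odd? (connected v r)

    excess : (Fin n → ℤ) → ℤ
    excess t = sum (λ v → sign (parity v) * t v)

    -- Superpose walks from all vertices to `r`, the one from `v` starting with weight `t v`;
    -- `excess t` collects what arrives at `r`.
    realisable-up-to-root : ∀ t → Realisable G (λ x → t x + excess t * δ r x)
    realisable-up-to-root t = realisable-cong collect
      (realisable-sum (λ v → realisable-walk (connected v r) (t v)))
      where
      δ-comm : ∀ v x → δ v x ≡ δ x v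
      δ-comm v x with v ≟ x
      ... | yes refl = refl
      ... | no  v≢x  = trans (δ-≢ v≢x) (≡-sym (δ-≢ (v≢x ∘ ≡-sym)))

      collect : ∀ x → sum (λ v → t v * δ v x + (sign (parity v) * t v) * δ r x) ≡ t x + excess t * δ r x
      collect x = begin
        sum (λ v → t v * δ v x + (sign (parity v) * t v) * δ r x)
          ≡⟨ ∑-distrib-+ (λ v → t v * δ v x) _ ⟩
        sum (λ v → t v * δ v x) + sum (λ v → (sign (parity v) * t v) * δ r x)
          ≡⟨ cong₂ _+_
               (trans (sum-cong-≗ (λ v → trans (cong (t v *_) (δ-comm v x)) (ℤ.*-comm (t v) (δ x v)))) (sum-δ t x))
               (≡-sym (*-distribʳ-sum (δ r x) (λ v → sign (parity v) * t v))) ⟩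
        t x + excess t * δ r x ∎

    -- Changing signs does not change parity: `excess t + sum t` is even term by term.
    excess-even : ∀ t → + 2 ∣ sum t → + 2 ∣ excess t
    excess-even t 2∣t = ∣m+n∣n⇒∣m
      (subst (+ 2 ∣_) (∑-distrib-+ (λ v → sign (parity v) * t v) t) (∣-sum (λ v → sign-even (parity v) (t v))))
      2∣t
      where
      sign-even : ∀ b a → + 2 ∣ sign b * a + a
      sign-even true  a = divides a (twice a)
        where
        twice : ∀ a → 1ℤ * a + a ≡ a * + 2
        twice = solve-∀
      sign-even false a = divides 0ℤ (cancel a)
        where
        cancel : ∀ a → - 1ℤ * a + a ≡ 0ℤ
        cancel = solve-∀

    -- The edge uv closes the walks from u and v to r up to an odd closed walk through r.
    realisable-2δ : ∀ {u v} → Adj G u v → parity u ≡ parity v → ∀ a → Realisable G (λ x → (a * + 2) * δ r x)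
    realisable-2δ {u} {v} uv same a = realisable-cong cancel
      (realisable-+ (realisable-edge uv b)
        (realisable-+ (realisable-walk (connected u r) (- b)) (realisable-walk (connected v r) (- b))))
      where
      -- Chosen so that each of the two walks, started with `- b`, delivers exactly `a` at `r`.
      b : ℤ
      b = - (sign (parity u) * a)

      regroup : ∀ b c d e f → b * d + b * e + ((- b * d + c * f) + (- b * e + c * f)) ≡ (c * + 2) * f
      regroup = solve-∀

      square : ∀ p → sign p * - - (sign p * a) ≡ a
      square true  = eq a
        where
        eq : ∀ a → 1ℤ * - - (1ℤ * a) ≡ a
        eq = solve-∀
      square false = eq a
        where
        eq : ∀ a → - 1ℤ * - - (- 1ℤ * a) ≡ a
        eq = solve-∀

      cancel : ∀ x → b * δ u x + b * δ v x
                 + ((- b * δ u x + (sign (parity u) * - b) * δ r x) + (- b * δ v x + (sign (parity v) * - b) * δ r x))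
               ≡ (a * + 2) * δ r x
      cancel x rewrite ≡-sym same | square (parity u) = regroup b a (δ u x) (δ v x) (δ r x)

    realisable-even : ∀ {u v} → Adj G u v → parity u ≡ parity v → ∀ t → + 2 ∣ sum t → Realisable G t
    realisable-even uv same t 2∣t with excess-even t 2∣t
    ... | divides k eq = realisable-cong cancel
      (realisable-+ (realisable-up-to-root t) (realisable-2δ uv same (- k)))
      where
      regroup : ∀ t k d → t + (k * + 2) * d + (- k * + 2) * d ≡ t
      regroup = solve-∀

      cancel : ∀ x → t x + excess t * δ r x + (- k * + 2) * δ r x ≡ t x
      cancel x rewrite eq = regroup (t x) k (δ r x)

-- Reduction modulo 4

-- The shift by 1 undoes the one in `colourValue`: a multiple of 4 receives the colour 4.
residue : ℤ → Fin 4
residue w = fromℕ< (n%ℕd<d (w - 1ℤ) 4)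

residue-value : ∀ w → + 4 ∣ + colourValue (residue w) - w
residue-value w = divides (- q) (begin
  + colourValue (residue w) - w            ≡⟨ cong (λ k → 1ℤ + + k - w) (toℕ-fromℕ< (n%ℕd<d (w - 1ℤ) 4)) ⟩
  1ℤ + + r - w                             ≡⟨ shift (+ r) w ⟩
  + r - (w - 1ℤ)                           ≡⟨ cong (λ z → + r - z) (a≡a%ℕn+[a/ℕn]*n (w - 1ℤ) 4) ⟩
  + r - (+ r + q * + 4)                    ≡⟨ cancel (+ r) q ⟩
  - q * + 4                                ∎)
  where
  q : ℤ
  q = (w - 1ℤ) /ℕ 4

  r : ℕ
  r = (w - 1ℤ) %ℕ 4

  shift : ∀ r w → 1ℤ + r - w ≡ r - (w - 1ℤ)
  shift = solve-∀

  cancel : ∀ r q → r - (r + q * + 4) ≡ - q * + 4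
  cancel = solve-∀

-- Distinctness is required modulo 4, since reducing the weights preserves vertex sums only modulo
-- 4.
Distinguishes : Graph n → (Fin n → ℤ) → Set
Distinguishes G t = ∀ x y → Adj G x y → ¬ (+ 4 ∣ t x - t y)

module _ {G : Graph n} where

  reduce : {t : Fin n → ℤ} → Realisable G t → EdgeColouring G 4
  reduce R = record
    { col     = λ u v → residue (weight R u v)
    ; col-sym = λ u v → cong residue (weight-sym R u v)
    }

  σ-reduce : {t : Fin n → ℤ} (R : Realisable G t) → ∀ x → + 4 ∣ + σ (reduce R) x - t x
  σ-reduce {t} R x = subst (+ 4 ∣_) split (∣-sum termwise)
    where
    I : Fin n → ℤ
    I y = indicator (adj? G x y)

    c : Fin n → ℤ
    c y = + colourValue (residue (weight R x y))

    termwise : ∀ y → + 4 ∣ I y * (c y - weight R x y)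
    termwise y = ∣n⇒∣m*n (I y) (residue-value (weight R x y))

    distribute : ∀ i c w → i * (c - w) ≡ i * c + - 1ℤ * (i * w)
    distribute = solve-∀

    negate : ∀ s t → s + - 1ℤ * t ≡ s - t
    negate = solve-∀

    split : sum (λ y → I y * (c y - weight R x y)) ≡ + σ (reduce R) x - t x
    split = begin
      sum (λ y → I y * (c y - weight R x y))
        ≡⟨ sum-cong-≗ (λ y → distribute (I y) (c y) (weight R x y)) ⟩
      sum (λ y → I y * c y + - 1ℤ * (I y * weight R x y))
        ≡⟨ ∑-distrib-+ (λ y → I y * c y) _ ⟩
      sum (λ y → I y * c y) + sum (λ y → - 1ℤ * (I y * weight R x y))
        ≡⟨ cong₂ _+_ (≡-sym (sum-filter-tabulate (adj? G x) (λ y → colourValue (residue (weight R x y))) id))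
                     (≡-sym (*-distribˡ-sum (- 1ℤ) (λ y → I y * weight R x y))) ⟩
      + σ (reduce R) x + - 1ℤ * sum (λ y → I y * weight R x y)
        ≡⟨ cong (λ z → + σ (reduce R) x + - 1ℤ * z) (weight-sum R x) ⟩
      + σ (reduce R) x + - 1ℤ * t x
        ≡⟨ negate (+ σ (reduce R) x) (t x) ⟩
      + σ (reduce R) x - t x ∎

  realisable-distinguishes : {t : Fin n → ℤ} → Realisable G t → Distinguishes G t →
    Σ (EdgeColouring G 4) NeighbourSumDistinguishing
  realisable-distinguishes {t} R distinct = reduce R , λ x y xy σx≡σy → distinct x y xy
    (subst (+ 4 ∣_) (difference (+ σ (reduce R) y) (t x) (t y))
      (∣m∣n⇒∣m-n (σ-reduce R y) (subst (λ s → + 4 ∣ + s - t x) σx≡σy (σ-reduce R x))))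
    where
    difference : ∀ s a b → (s - b) - (s - a) ≡ a - b
    difference = solve-∀

-- Greedy colouring and relabelling

-- If every colour occurred in `xs`, its index would inject the `n` colours into fewer than `n`
-- positions.
missing : (xs : List (Fin n)) → length xs ℕ.< n → ∃ λ c → c ∉ xs
missing {n} xs short with any? (λ c → ¬? (DecMembership._∈?_ _≟_ c xs))
... | yes found = found
... | no  none  with pigeonhole short (λ c → index (covered c))
  where
  covered : ∀ c → c ∈ xs
  covered c = decidable-stable (DecMembership._∈?_ _≟_ c xs) (λ c∉xs → none (c , c∉xs))
... | i , j , i<j , eq = contradiction (SetoidMembership.index-injective (setoid (Fin n)) _ _ eq) (<⇒≢ i<j)

module _ {G : Graph n} {k : ℕ} (degree< : ∀ x → degree G x ℕ.< k) where

  greedy-on : (vs : List (Fin n)) →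
    ∃ λ (c : Fin n → Fin k) → ∀ {x y} → x ∈ vs → y ∈ vs → Adj G x y → c x ≢ c y
  -- A default colour exists because the degree bound at `x` forces `k` to be positive.
  greedy-on [] = (λ x → let (c , _) = missing [] (ℕ.≤-<-trans ℕ.z≤n (degree< x)) in c) , λ ()
  greedy-on (v ∷ vs) with greedy-on vs
  -- The new colour avoids those of all neighbours of `v`, inside `vs` or not; there are fewer than
  -- `k` of them.
  ... | c , proper with missing (map c (neighbours G v)) (subst (ℕ._< k) (≡-sym (length-map c (neighbours G v))) (degree< v))
  ...   | a , a∉ = c′ , proper′
    where
    c′ : Fin n → Fin k
    c′ = updateAt c v (const a)

    c′-old : ∀ {x} → x ≢ v → c′ x ≡ c x
    c′-old {x} x≢v = updateAt-minimal x v c x≢v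

    a-fresh : ∀ {y} → Adj G v y → a ≢ c y
    a-fresh {y} vy refl = a∉ (∈-map⁺ c (∈-filter⁺ (adj? G v) (∈-allFin y) vy))

    c′-fresh : ∀ {y} → Adj G v y → c′ v ≢ c′ y
    c′-fresh {y} vy eq = a-fresh vy (trans (≡-sym (updateAt-updates v c)) (trans eq (c′-old λ { refl → irrefl G vy })))

    older : ∀ {x} → x ≢ v → x ∈ v ∷ vs → x ∈ vs
    older x≢v (here x≡v)   = contradiction x≡v x≢v
    older x≢v (there x∈vs) = x∈vs

    proper′ : ∀ {x y} → x ∈ v ∷ vs → y ∈ v ∷ vs → Adj G x y → c′ x ≢ c′ y
    proper′ {x} {y} x∈ y∈ xy eq with x ≟ v | y ≟ v
    ... | yes refl | _        = c′-fresh xy eq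
    ... | no  _    | yes refl = c′-fresh (sym G xy) (≡-sym eq)
    ... | no  x≢v  | no  y≢v  = proper (older x≢v x∈) (older y≢v y∈) xy
      (trans (≡-sym (c′-old x≢v)) (trans eq (c′-old y≢v)))

  greedy : ∃ λ (c : Fin n → Fin k) → ∀ {x y} → Adj G x y → c x ≢ c y
  greedy with greedy-on (allFin n)
  ... | c , proper = c , proper (∈-allFin _) (∈-allFin _)

even⊎odd : ∀ z → + 2 ∣ z ⊎ + 2 ∣ z - 1ℤ
even⊎odd z with z %ℕ 2 | n%ℕd<d z 2 | a≡a%ℕn+[a/ℕn]*n z 2
... | 0 | _ | eq = inj₁ (divides (z /ℕ 2) (trans eq (ℤ.+-identityˡ _)))
... | 1 | _ | eq = inj₂ (divides (z /ℕ 2) (trans (cong (_- 1ℤ) eq) (cancel (z /ℕ 2 * + 2))))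
  where
  cancel : ∀ a → 1ℤ + a - 1ℤ ≡ a
  cancel = solve-∀
... | ℕ.suc (ℕ.suc _) | ℕ.s≤s (ℕ.s≤s ()) | _

-- Were all three odd, subtracting the even numbers `a - 1`, `b - 1`, `c - 1` from the even total
-- would leave 3.
some-even : ∀ a b c → + 2 ∣ a + (b + c) → + 2 ∣ a ⊎ + 2 ∣ b ⊎ + 2 ∣ c
some-even a b c 2∣abc with even⊎odd a | even⊎odd b | even⊎odd c
... | inj₁ a-even | _           | _           = inj₁ a-even
... | inj₂ _      | inj₁ b-even | _           = inj₂ (inj₁ b-even)
... | inj₂ _      | inj₂ _      | inj₁ c-even = inj₂ (inj₂ c-even)
... | inj₂ a-odd  | inj₂ b-odd  | inj₂ c-odd  = contradiction
  (subst (+ 2 ∣_) (regroup a b c) (∣m∣n⇒∣m-n 2∣abc (∣m∣n⇒∣m+n a-odd (∣m∣n⇒∣m+n b-odd c-odd))))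
  (from-no (+ 2 ∣? + 3))
  where
  regroup : ∀ a b c → a + (b + c) - (a - 1ℤ + (b - 1ℤ + (c - 1ℤ))) ≡ + 3
  regroup = solve-∀

-- Relabelling by such an `f` turns a proper colouring into vertex sums that differ modulo 4 along
-- every edge.
Separating : (Fin 4 → ℤ) → Set
Separating f = ∀ i j → i ≢ j → ¬ (+ 4 ∣ f i - f j)

separating? : (f : Fin 4 → ℤ) → Dec (Separating f)
separating? f = all? λ i → all? λ j → ¬? (i ≟ j) →-dec ¬? (+ 4 ∣? f i - f j)

-- Labellings of the four colours whose odd labels fall on {0,1}, {0,2} and {1,2}:
-- every colour gets an odd label an even number of times.
label₁ label₂ label₃ : Fin 4 → ℤ
label₁ 0F = + 1
label₁ 1F = + 3
label₁ 2F = + 0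
label₁ 3F = + 2
label₂ 0F = + 1
label₂ 1F = + 0
label₂ 2F = + 3
label₂ 3F = + 2
label₃ 0F = + 0
label₃ 1F = + 1
label₃ 2F = + 3
label₃ 3F = + 2

labels-even : ∀ i → + 2 ∣ label₁ i + (label₂ i + label₃ i)
labels-even 0F = divides (+ 1) refl
labels-even 1F = divides (+ 2) refl
labels-even 2F = divides (+ 3) refl
labels-even 3F = divides (+ 3) refl

-- By `labels-even` the totals of the three labellings add up to an even number, so one of these
-- totals is even.
even-relabelling : (c : Fin n → Fin 4) → ∃ λ f → Separating f × + 2 ∣ sum (f ∘ c)
even-relabelling c with some-even (sum (label₁ ∘ c)) (sum (label₂ ∘ c)) (sum (label₃ ∘ c)) total
  where
  total : + 2 ∣ sum (label₁ ∘ c) + (sum (label₂ ∘ c) + sum (label₃ ∘ c))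
  total = subst (+ 2 ∣_)
    (trans (∑-distrib-+ (label₁ ∘ c) _) (cong (λ z → sum (label₁ ∘ c) + z) (∑-distrib-+ (label₂ ∘ c) (label₃ ∘ c))))
    (∣-sum (labels-even ∘ c))
... | inj₁ even        = label₁ , from-yes (separating? label₁) , even
... | inj₂ (inj₁ even) = label₂ , from-yes (separating? label₂) , even
... | inj₂ (inj₂ even) = label₃ , from-yes (separating? label₃) , even

even-distinguishing : (G : Graph n) → Regular 3 G → ∃ λ t → Distinguishes G t × + 2 ∣ sum t
even-distinguishing G regular with greedy {G = G} {4} (λ x → ℕ.≤-reflexive (cong ℕ.suc (regular x)))
... | c , proper with even-relabelling c
... | f , separating , even = f ∘ c , (λ x y xy → separating (c x) (c y) (proper xy)) , even

-- Bipartite graphs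

two-neighbours : (G : Graph n) → Regular 3 G → ∀ x → ∃₂ λ y z → Adj G x y × Adj G x z × y ≢ z
two-neighbours {n} G regular x
  with neighbours G x | regular x | all-filter (adj? G x) (allFin n) | filter⁺ (adj? G x) (allFin⁺ n)
... | y ∷ z ∷ _ | _ | xy ∷ xz ∷ _ | (y≢z ∷ _) ∷ _ = y , z , xy , xz , y≢z

-- Here `x` is on the side of `r` and `y` on the other; `dx` and `dy` stand for `δ r x` and `δ r y`.
-- The difference of the sums is -1 if `x` is not `r`, and `E - 1` if it is.
root-distinguished : ∀ {E tx ty dx dy} → ¬ (+ 4 ∣ E - 1ℤ) → tx ≡ 0ℤ → ty ≡ 1ℤ → dy ≡ 0ℤ → dx ≡ 0ℤ ⊎ dx ≡ 1ℤ →
  ¬ (+ 4 ∣ tx + E * dx - (ty + E * dy))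
root-distinguished {E} E≢1 refl refl refl (inj₁ refl) 4∣ =
  from-no (+ 4 ∣? - 1ℤ) (subst (+ 4 ∣_) (simplify E) 4∣)
  where
  simplify : ∀ e → 0ℤ + e * 0ℤ - (1ℤ + e * 0ℤ) ≡ - 1ℤ
  simplify = solve-∀
root-distinguished {E} E≢1 refl refl refl (inj₂ refl) 4∣ = E≢1 (subst (+ 4 ∣_) (simplify E) 4∣)
  where
  simplify : ∀ e → 0ℤ + e * 1ℤ - (1ℤ + e * 0ℤ) ≡ e - 1ℤ
  simplify = solve-∀

-- Raising by 1 the weights of two edges ra and rb turns the sum 1 (mod 4) at r into 3, and the sums 1 at a and b into 2.
root-distinguished-raised : ∀ {E tx ty rx ax bx ry ay by} → + 4 ∣ E - 1ℤ → tx ≡ 0ℤ → ty ≡ 1ℤ →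
  ry ≡ 0ℤ → ax ≡ 0ℤ → bx ≡ 0ℤ → rx ≡ 0ℤ ⊎ rx ≡ 1ℤ → ay + by ≡ 0ℤ ⊎ ay + by ≡ 1ℤ →
  ¬ (+ 4 ∣ tx + E * rx + (1ℤ * rx + 1ℤ * ax + (1ℤ * rx + 1ℤ * bx))
         - (ty + E * ry + (1ℤ * ry + 1ℤ * ay + (1ℤ * ry + 1ℤ * by))))
root-distinguished-raised {E} {ay = ay} {by} E≡1 refl refl refl refl refl (inj₁ refl) small 4∣ =
  gap (ay + by) small (subst (+ 4 ∣_) (simplify E ay by) 4∣)
  where
  simplify : ∀ e d d′ →
    0ℤ + e * 0ℤ + (1ℤ * 0ℤ + 1ℤ * 0ℤ + (1ℤ * 0ℤ + 1ℤ * 0ℤ)) - (1ℤ + e * 0ℤ + (1ℤ * 0ℤ + 1ℤ * d + (1ℤ * 0ℤ + 1ℤ * d′)))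
    ≡ - 1ℤ - (d + d′)
  simplify = solve-∀

  gap : ∀ d → d ≡ 0ℤ ⊎ d ≡ 1ℤ → ¬ (+ 4 ∣ - 1ℤ - d)
  gap d (inj₁ refl) = from-no (+ 4 ∣? - (+ 1))
  gap d (inj₂ refl) = from-no (+ 4 ∣? - (+ 2))
-- The case where `x` is `r`: modulo 4 the difference is 2 or 1, according to whether `y` is an end
-- of a raised edge.
root-distinguished-raised {E} {ay = ay} {by} E≡1 refl refl refl refl refl (inj₂ refl) small 4∣ =
  gap (ay + by) small (∣m+n∣m⇒∣n (subst (+ 4 ∣_) (simplify E ay by) 4∣) E≡1)
  where
  simplify : ∀ e d d′ →
    0ℤ + e * 1ℤ + (1ℤ * 1ℤ + 1ℤ * 0ℤ + (1ℤ * 1ℤ + 1ℤ * 0ℤ)) - (1ℤ + e * 0ℤ + (1ℤ * 0ℤ + 1ℤ * d + (1ℤ * 0ℤ + 1ℤ * d′)))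
    ≡ (e - 1ℤ) + (+ 2 - (d + d′))
  simplify = solve-∀

  gap : ∀ d → d ≡ 0ℤ ⊎ d ≡ 1ℤ → ¬ (+ 4 ∣ + 2 - d)
  gap d (inj₁ refl) = from-no (+ 4 ∣? + 2)
  gap d (inj₂ refl) = from-no (+ 4 ∣? + 1)

module _ {G : Graph n} (regular : Regular 3 G) (connected : Connected G) (r : Fin n) where

  side : Fin n → Bool
  side = parity connected r

  target : Fin n → ℤ
  target x = if does (side x Bool.≟ side r) then 0ℤ else 1ℤ

  -- As `target r` is 0, this is the entire sum that `realisable-up-to-root` gives at `r`.
  surplus : ℤ
  surplus = excess connected r target

  -- Up to symmetry, an edge has one end on the side of r and the other end on the opposite side.
  realisable-across : (∀ {x y} → Adj G x y → side x ≢ side y) → {s : Fin n → ℤ} → Realisable G s →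
    (∀ x y → side x ≡ side r → side y ≢ side r → ¬ (+ 4 ∣ s x - s y)) → Σ (EdgeColouring G 4) NeighbourSumDistinguishing
  realisable-across proper {s} R across = realisable-distinguishes R distinct
    where
    swap : ∀ a b → - (a - b) ≡ b - a
    swap = solve-∀

    distinct : Distinguishes G s
    distinct x y xy 4∣ with side x Bool.≟ side r | side y Bool.≟ side r
    ... | yes px | yes py = proper xy (trans px (≡-sym py))
    ... | yes px | no  py = across x y px py 4∣
    ... | no  px | yes py = across y x py px (subst (+ 4 ∣_) (swap (s x) (s y)) (∣m⇒∣-m 4∣))
    ... | no  px | no  py = proper xy (trans (Bool.¬-not px) (≡-sym (Bool.¬-not py)))

  same-side : ∀ {x} → side x ≡ side r → target x ≡ 0ℤ
  same-side {x} px with side x Bool.≟ side r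
  ... | yes _  = refl
  ... | no  px′ = contradiction px px′

  other-side : ∀ {x} → side x ≢ side r → target x ≡ 1ℤ
  other-side {x} px with side x Bool.≟ side r
  ... | yes px′ = contradiction px′ px
  ... | no  _   = refl

  away-root : ∀ {y} → side y ≢ side r → δ r y ≡ 0ℤ
  away-root {y} py = δ-≢ {i = r} {y} λ { refl → py refl }

  away : ∀ {x y} → side x ≡ side r → side y ≢ side r → δ y x ≡ 0ℤ
  away {x} {y} px py = δ-≢ {i = y} {x} λ { refl → py px }

  bipartite : (∀ {x y} → Adj G x y → side x ≢ side y) → Σ (EdgeColouring G 4) NeighbourSumDistinguishing
  bipartite proper = helper (+ 4 ∣? surplus - 1ℤ) (two-neighbours G regular r)
    where
    helper : Dec (+ 4 ∣ surplus - 1ℤ) → (∃₂ λ a b → Adj G r a × Adj G r b × a ≢ b) →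
      Σ (EdgeColouring G 4) NeighbourSumDistinguishing
    -- All neighbours of `r` have sum 1, so a conflict at `r` arises only if `surplus` is 1 modulo
    -- 4.
    helper (no E≢1) _ = realisable-across proper
      (realisable-up-to-root connected r target)
      (λ x y px py → root-distinguished {surplus} {dx = δ r x} E≢1 (same-side px) (other-side py) (away-root py) (δ-0⊎1 r x))
    helper (yes E≡1) (a , b , ra , rb , a≢b) = realisable-across proper
      (realisable-+ (realisable-up-to-root connected r target) (realisable-+ (realisable-edge ra 1ℤ) (realisable-edge rb 1ℤ)))
      (λ x y px py → root-distinguished-raised {surplus} {rx = δ r x} {ay = δ a y} E≡1 (same-side px) (other-side py)
        (away-root py) (away px (proper ra ∘ ≡-sym)) (away px (proper rb ∘ ≡-sym)) (δ-0⊎1 r x) (δ-+-0⊎1 a≢b y))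

-- Odd closed walk or bipartition.

monochromatic-or-proper : (G : Graph n) (p : Fin n → Bool) →
  (∃₂ λ u v → Adj G u v × p u ≡ p v) ⊎ (∀ {u v} → Adj G u v → p u ≢ p v)
monochromatic-or-proper G p with any? (λ u → any? (λ v → adj? G u v ×-dec p u Bool.≟ p v))
... | yes (u , v , found) = inj₁ (u , v , found)
... | no  none            = inj₂ λ uv eq → none (_ , _ , uv , eq)

theorem4 : ∀ (n : ℕ) (G : Graph n) → Regular 3 G → Connected G →
    Σ (EdgeColouring G 4) NeighbourSumDistinguishing
-- The empty graph is separate because it has no vertex to serve as root.
theorem4 ℕ.zero    G regular connected = record { col = λ () ; col-sym = λ () } , λ ()
theorem4 (ℕ.suc n) G regular connected =
  -- An edge whose ends have equal walk parity yields an odd closed walk through the root; without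
  -- such edges, parity is a bipartition.
  [ (λ (_ , _ , uv , same) →
      let (t , distinct , even) = even-distinguishing G regular
      in  realisable-distinguishes (realisable-even connected zero uv same t even) distinct)
  , bipartite regular connected zero
  ]′ (monochromatic-or-proper G (parity connected zero))
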